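{- For every integer $n\ge1$, the Bernoulli number $b_n$ can be written as the following fraction (a quotient of two integers): $$b_n=\frac{(n+1)!\displaystyle\sum_{k=1}^n(-1)^k\frac1{k+1}\sum_{\substack{n_1+\cdots+n_k=n\\ n_i\ge1}}\binom{n}{n_1,n_2,\dots,n_k}}{(n+1)!}.$$
   Context: The Bernoulli numbers $b_n$ ($n\ge0$) are defined by $\frac{x}{e^x-1}=\sum_{n=0}^\infty b_n\frac{x^n}{n!}$. The inner sum is over ordered $k$-tuples of positive integers $(n_1,\dots,n_k)$ with sum $n$, and $\binom{n}{n_1,\dots,n_k}=\frac{n!}{n_1!\cdots n_k!}$. -}

module Defs where

open import Data.Integer.Base using (ℤ; +_; 1ℤ)
open import Data.List.Base as List using (List; []; _∷_; upTo; cartesianProductWith; filter)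
open import Data.List.Relation.Unary.All as All using (All)
open import Data.List.Relation.Unary.All.Properties using (map⁺)
open import Data.Nat.Base using (ℕ; zero; suc; _∸_; _!; NonZero)
open import Data.Nat.ListAction using (product)
open import Data.Nat.ListAction.Properties using (product≢0)
open import Data.Nat.Properties using (_≟_; _!≢0)
open import Data.Rational.Base using (ℚ; 0ℚ; 1ℚ; _/_; _+_; _-_; _*_)
open import Data.Vec.Base as Vec using (Vec; []; _∷_; toList)
open import Relation.Binary.PropositionalEquality using (_≗_)

Σ[_] : {A : Set} → List A → (A → ℚ) → ℚ
Σ[ xs ] f = List.foldr (λ x s → f x + s) 0ℚ xs

[1⋯_] : ℕ → List ℕ
[1⋯ n ] = List.map suc (upTo n)

infixl 7 _/!_
_/!_ : ℤ → ℕ → ℚ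
z /! n = (z / (n !)) {{n !≢0}}

-- Formal power series over ℚ, given by their coefficients; equality is _≗_.
Series : Set
Series = ℕ → ℚ

infixl 6 _⊖_
_⊖_ : Series → Series → Series
(f ⊖ g) n = f n - g n

infixl 7 _⊛_
_⊛_ : Series → Series → Series
(f ⊛ g) n = Σ[ upTo (suc n) ] λ i → f i * g (n ∸ i)

𝟏 : Series
𝟏 zero    = 1ℚ
𝟏 (suc _) = 0ℚ

X : Series
X 1 = 1ℚ
X _ = 0ℚ

exp : Series
exp n = 1ℤ /! n

egf : (ℕ → ℚ) → Series
egf b n = b n * (1ℤ /! n)

-- Σ bₙ xⁿ/n! is the quotient x/(eˣ - 1).  As eˣ - 1 has zero constant term it
-- is not invertible in ℚ[[x]], so the quotient is expressed by multiplying out;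
-- ℚ[[x]] is an integral domain, so this determines b.
IsBernoulli : (ℕ → ℚ) → Set
IsBernoulli b = egf b ⊛ (exp ⊖ 𝟏) ≗ X

tuples : {A : Set} → List A → (k : ℕ) → List (Vec A k)
tuples xs zero    = [] ∷ []
tuples xs (suc k) = cartesianProductWith _∷_ xs (tuples xs k)

-- Each ordered k-tuple of positive integers with sum n, listed once: the
-- entries of such a tuple are at most n.
compositions : (n k : ℕ) → List (Vec ℕ k)
compositions n k = filter (λ v → Vec.sum v ≟ n) (tuples [1⋯ n ] k)

-- n! / (n₁! ⋯ nₖ!), with the division taken in ℚ.
multinomial : ∀ {k} → ℕ → Vec ℕ k → ℚ
multinomial n v = (+ (n !) / product factorials) {{product≢0 nonZero}}
  where
  factorials : List ℕ
  factorials = List.map _! (toList v)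

  nonZero : All NonZero factorials
  nonZero = map⁺ (All.universal _!≢0 (toList v))

{-# OPTIONS --safe #-}
module Submission where

-- Put u = eˣ - 1.  As u′ = u + 1, we have (uᵏ⁺¹)′ = (k + 1)(uᵏ⁺¹ + uᵏ), so the
-- derivative of Σ_{k≤N} (-1)ᵏ uᵏ⁺¹/(k + 1) telescopes to 1 up to degree N.  Hence
-- u · Σ_{k≤N} (-1)ᵏ uᵏ/(k + 1) agrees with x up to degree N + 1, and cancelling u
-- identifies the generating series of the Bernoulli numbers.  The same derivative
-- gives a recurrence showing that n! [xⁿ] uᵏ, which is the sum of the multinomial
-- coefficients, is an integer.

open import Defs
open import Data.Bool.Base using (true; false; if_then_else_)
open import Data.Integer.Base as ℤ using (ℤ; +_; 1ℤ; -1ℤ)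
import Data.Integer.Properties as ℤ
open import Data.List.Base as List using (List; []; _∷_; _++_; upTo; cartesianProductWith; filter)
open import Data.List.Properties using (map-upTo)
open import Data.List.Relation.Unary.All as All using (All; []; _∷_)
open import Data.List.Relation.Unary.All.Properties using (applyUpTo⁺₁)
open import Data.Nat.Base as ℕ using (ℕ; zero; suc; _!; _≤_; _<_; z≤n; s≤s; NonZero)
open import Data.Nat.Divisibility using (_∣_; divides; m∣m*n; ∣-trans; m≤n⇒m!∣n!)
open import Data.Nat.ListAction using (product)
import Data.Nat.Properties as ℕ
open import Data.Product.Base using (∃; _×_; _,_)
open import Data.Rational.Base using (ℚ; 0ℚ; 1ℚ; _/_; _+_; _-_; _*_; -_; fromℚᵘ; toℚᵘ)
open import Data.Rational.Properties
open import Data.Rational.Solver using (module +-*-Solver)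
open import Data.Rational.Unnormalised.Base as ℚᵘ using (mkℚᵘ; *≡*)
import Data.Rational.Unnormalised.Properties as ℚᵘ
open import Data.Vec.Base as Vec using (Vec; []; _∷_; toList)
open import Function.Base using (_∘_)
open import Level using (0ℓ)
open import Relation.Binary.PropositionalEquality
open import Relation.Nullary.Decidable.Core using (does)
open import Relation.Unary using (Pred; Decidable)

open +-*-Solver using (solve; _:+_; _:*_; :-_; _:-_; _:=_; con)
open ≡-Reasoning

private
  variable
    A B : Set
    p q : ℚ
    f f′ g g′ : Series

-- Rational numbers

fromℚᵘ-homo-* : ∀ p q → fromℚᵘ p * fromℚᵘ q ≡ fromℚᵘ (p ℚᵘ.* q)
fromℚᵘ-homo-* p q = toℚᵘ-injective (begin-equality
  toℚᵘ (fromℚᵘ p * fromℚᵘ q)               ≃⟨ toℚᵘ-homo-* (fromℚᵘ p) (fromℚᵘ q) ⟩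
  toℚᵘ (fromℚᵘ p) ℚᵘ.* toℚᵘ (fromℚᵘ q)     ≃⟨ ℚᵘ.*-cong (toℚᵘ-fromℚᵘ p) (toℚᵘ-fromℚᵘ q) ⟩
  p ℚᵘ.* q                                 ≃⟨ toℚᵘ-fromℚᵘ (p ℚᵘ.* q) ⟨
  toℚᵘ (fromℚᵘ (p ℚᵘ.* q))                 ∎′)
  where open ℚᵘ.≤-Reasoning renaming (_∎ to _∎′)

fromℚᵘ-homo-+ : ∀ p q → fromℚᵘ p + fromℚᵘ q ≡ fromℚᵘ (p ℚᵘ.+ q)
fromℚᵘ-homo-+ p q = toℚᵘ-injective (begin-equality
  toℚᵘ (fromℚᵘ p + fromℚᵘ q)               ≃⟨ toℚᵘ-homo-+ (fromℚᵘ p) (fromℚᵘ q) ⟩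
  toℚᵘ (fromℚᵘ p) ℚᵘ.+ toℚᵘ (fromℚᵘ q)     ≃⟨ ℚᵘ.+-cong (toℚᵘ-fromℚᵘ p) (toℚᵘ-fromℚᵘ q) ⟩
  p ℚᵘ.+ q                                 ≃⟨ toℚᵘ-fromℚᵘ (p ℚᵘ.+ q) ⟨
  toℚᵘ (fromℚᵘ (p ℚᵘ.+ q))                 ∎′)
  where open ℚᵘ.≤-Reasoning renaming (_∎ to _∎′)

/-*-/ : ∀ i j m n .{{_ : NonZero m}} .{{_ : NonZero n}} .{{_ : NonZero (m ℕ.* n)}} →
        (i / m) * (j / n) ≡ (i ℤ.* j) / (m ℕ.* n)
-- For successor denominators `fromℚᵘ (mkℚᵘ i m)` is `i / suc m` by definition.
/-*-/ i j (suc m) (suc n) = fromℚᵘ-homo-* (mkℚᵘ i m) (mkℚᵘ j n)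

/1-homo-+ : ∀ i j → i / 1 + j / 1 ≡ (i ℤ.+ j) / 1
/1-homo-+ i j = trans (fromℚᵘ-homo-+ (mkℚᵘ i 0) (mkℚᵘ j 0))
  (cong (_/ 1) (cong₂ ℤ._+_ (ℤ.*-identityʳ i) (ℤ.*-identityʳ j)))

/1-homo-* : ∀ i j → (i / 1) * (j / 1) ≡ (i ℤ.* j) / 1
/1-homo-* i j = /-*-/ i j 1 1

ι : ℕ → ℚ
ι n = + n / 1

ι-suc : ∀ n → ι (suc n) ≡ 1ℚ + ι n
ι-suc n = sym (/1-homo-+ 1ℤ (+ n))

ι-* : ∀ m n → ι (m ℕ.* n) ≡ ι m * ι n
ι-* m n = sym (trans (/1-homo-* (+ m) (+ n)) (cong (_/ 1) (sym (ℤ.pos-* m n))))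

/-as-* : ∀ i n .{{_ : NonZero n}} → i / n ≡ (i / 1) * (1ℤ / n)
/-as-* i n@(suc _) = sym (trans (/-*-/ i 1ℤ 1 n)
  (/-cong (ℤ.*-identityʳ i) (ℕ.*-identityˡ n)))

ι-inverse : ∀ n .{{_ : NonZero n}} → ι n * (1ℤ / n) ≡ 1ℚ
ι-inverse n@(suc m) = trans (sym (/-as-* (+ n) n))
  (fromℚᵘ-cong {mkℚᵘ (+ n) m} {mkℚᵘ 1ℤ 0} (*≡* (ℤ.*-comm (+ n) 1ℤ)))

ι-cancelˡ : ∀ n .{{_ : NonZero n}} → ι n * p ≡ ι n * q → p ≡ q
ι-cancelˡ {p} {q} n eq = begin
  p                      ≡⟨ expand p ⟩
  (1ℤ / n) * (ι n * p)   ≡⟨ cong ((1ℤ / n) *_) eq ⟩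
  (1ℤ / n) * (ι n * q)   ≡⟨ expand q ⟨
  q                      ∎
  where
  expand : ∀ r → r ≡ (1ℤ / n) * (ι n * r)
  expand r = begin
    r                      ≡⟨ *-identityˡ r ⟨
    1ℚ * r                 ≡⟨ cong (_* r) (ι-inverse n) ⟨
    ι n * (1ℤ / n) * r     ≡⟨ solve 3 (λ a b c → a :* b :* c := b :* (a :* c)) refl (ι n) (1ℤ / n) r ⟩
    (1ℤ / n) * (ι n * r)   ∎

-- The left summand is explicit because unification cannot invert _+_ on ℚ.
+-congˡ : ∀ r → p ≡ q → r + p ≡ r + q
+-congˡ r = cong (λ s → r + s)

-- The sign has exactly the form used in the theorem, so that `bernoulliTerm` unfolds to the
-- theorem's summand.
sgn : ℕ → ℚ
sgn k = (-1ℤ ℤ.^ k) / 1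

sgn-suc : ∀ k → sgn (suc k) ≡ - sgn k
sgn-suc k = trans (sym (/1-homo-* -1ℤ (-1ℤ ℤ.^ k)))
  (trans (sym (neg-distribˡ-* 1ℚ (sgn k))) (cong -_ (*-identityˡ (sgn k))))

-- Rationals that are integers

IsInteger : ℚ → Set
IsInteger q = ∃ λ z → q ≡ z / 1

+-isInteger : IsInteger p → IsInteger q → IsInteger (p + q)
+-isInteger (i , refl) (j , refl) = i ℤ.+ j , /1-homo-+ i j

*-isInteger : IsInteger p → IsInteger q → IsInteger (p * q)
*-isInteger (i , refl) (j , refl) = i ℤ.* j , /1-homo-* i j

∣⇒isInteger : ∀ {m n} .{{_ : NonZero m}} → m ∣ n → IsInteger (ι n * (1ℤ / m))
∣⇒isInteger {m} (divides o refl) = + o , (begin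
  ι (o ℕ.* m) * (1ℤ / m)    ≡⟨ cong (_* (1ℤ / m)) (ι-* o m) ⟩
  ι o * ι m * (1ℤ / m)      ≡⟨ *-assoc (ι o) (ι m) (1ℤ / m) ⟩
  ι o * (ι m * (1ℤ / m))    ≡⟨ cong (ι o *_) (ι-inverse m) ⟩
  ι o * 1ℚ                  ≡⟨ *-identityʳ (ι o) ⟩
  ι o                       ∎)

-- Finite sums

Σ-cong : {F G : A → ℚ} → F ≗ G → ∀ xs → Σ[ xs ] F ≡ Σ[ xs ] G
Σ-cong eq []       = refl
Σ-cong eq (x ∷ xs) = cong₂ _+_ (eq x) (Σ-cong eq xs)

Σ-zero : (xs : List A) → Σ[ xs ] (λ _ → 0ℚ) ≡ 0ℚ
Σ-zero []       = refl
Σ-zero (x ∷ xs) = trans (+-identityˡ _) (Σ-zero xs)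

Σ-*ˡ : ∀ c (F : A → ℚ) xs → Σ[ xs ] (λ x → c * F x) ≡ c * Σ[ xs ] F
Σ-*ˡ c F []       = sym (*-zeroʳ c)
Σ-*ˡ c F (x ∷ xs) = trans (+-congˡ (c * F x) (Σ-*ˡ c F xs)) (sym (*-distribˡ-+ c (F x) (Σ[ xs ] F)))

Σ-map : (φ : A → B) (F : B → ℚ) → ∀ xs → Σ[ List.map φ xs ] F ≡ Σ[ xs ] (F ∘ φ)
Σ-map φ F []       = refl
Σ-map φ F (x ∷ xs) = +-congˡ (F (φ x)) (Σ-map φ F xs)

Σ-++ : (F : A → ℚ) → ∀ xs ys → Σ[ xs ++ ys ] F ≡ Σ[ xs ] F + Σ[ ys ] F
Σ-++ F []       ys = sym (+-identityˡ _)
Σ-++ F (x ∷ xs) ys = trans (+-congˡ (F x) (Σ-++ F xs ys)) (sym (+-assoc (F x) (Σ[ xs ] F) (Σ[ ys ] F)))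

Σ-filter : {P : Pred A 0ℓ} (P? : Decidable P) (F : A → ℚ) → ∀ xs →
           Σ[ filter P? xs ] F ≡ Σ[ xs ] (λ x → if does (P? x) then F x else 0ℚ)
Σ-filter P? F []       = refl
Σ-filter P? F (x ∷ xs) with does (P? x)
... | true  = +-congˡ (F x) (Σ-filter P? F xs)
... | false = trans (Σ-filter P? F xs) (sym (+-identityˡ _))

Σ-isInteger : {F : A → ℚ} → ∀ {xs} → All (IsInteger ∘ F) xs → IsInteger (Σ[ xs ] F)
Σ-isInteger []       = + 0 , refl
Σ-isInteger (z ∷ zs) = +-isInteger z (Σ-isInteger zs)

Σ-1⋯ : ∀ (F : ℕ → ℚ) n → Σ[ [1⋯ n ] ] F ≡ Σ[ upTo n ] (F ∘ suc)
Σ-1⋯ F n = Σ-map suc F (upTo n)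

Σ-upTo-suc : ∀ (F : ℕ → ℚ) n → Σ[ upTo (suc n) ] F ≡ F 0 + Σ[ upTo n ] (F ∘ suc)
-- The tail of `upTo (suc n)` reduces to `applyUpTo suc n`, which is `map suc (upTo n)` only through
-- `map-upTo`.
Σ-upTo-suc F n = +-congˡ (F 0)
  (trans (cong (λ xs → Σ[ xs ] F) (sym (map-upTo suc n))) (Σ-1⋯ F n))

-- Neighbouring summands share one `a k` with opposite signs. Splitting off the first summand leaves
-- -1 times the same sum for `a ∘ suc`, so the induction must run over all `a`.
Σ-telescope : ∀ (a : ℕ → ℚ) n →
              Σ[ upTo n ] (λ k → sgn k * (a (suc k) + a k)) ≡ a 0 - sgn n * a n
Σ-telescope a zero    = solve 1 (λ x → con 0ℚ := x :- con 1ℚ :* x) refl (a 0)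
Σ-telescope a (suc n) = begin
  Σ[ upTo (suc n) ] (λ k → sgn k * (a (suc k) + a k))
    ≡⟨ Σ-upTo-suc (λ k → sgn k * (a (suc k) + a k)) n ⟩
  1ℚ * (a 1 + a 0) + Σ[ upTo n ] (λ k → sgn (suc k) * (a (suc (suc k)) + a (suc k)))
    ≡⟨ +-congˡ (1ℚ * (a 1 + a 0)) (Σ-cong (λ k →
         trans (cong (_* (a (suc (suc k)) + a (suc k)))
                 (trans (sgn-suc k) (solve 1 (λ s → :- s := con (- 1ℚ) :* s) refl (sgn k))))
               (*-assoc (- 1ℚ) (sgn k) (a (suc (suc k)) + a (suc k)))) (upTo n)) ⟩
  1ℚ * (a 1 + a 0) + Σ[ upTo n ] (λ k → - 1ℚ * (sgn k * (a (suc (suc k)) + a (suc k))))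
    ≡⟨ +-congˡ (1ℚ * (a 1 + a 0)) (trans (Σ-*ˡ (- 1ℚ) (λ k → sgn k * (a (suc (suc k)) + a (suc k))) (upTo n))
         (cong (- 1ℚ *_) (Σ-telescope (a ∘ suc) n))) ⟩
  1ℚ * (a 1 + a 0) + - 1ℚ * (a 1 - sgn n * a (suc n))
    ≡⟨ solve 4 (λ x y s z → con 1ℚ :* (x :+ y) :+ con (- 1ℚ) :* (x :- s :* z) := y :- (:- s) :* z)
         refl (a 1) (a 0) (sgn n) (a (suc n)) ⟩
  a 0 - (- sgn n) * a (suc n)
    ≡⟨ cong (λ s → a 0 - s * a (suc n)) (sgn-suc n) ⟨
  a 0 - sgn (suc n) * a (suc n)
    ∎

-- Formal power series

infixl 6 _⊕_
_⊕_ : Series → Series → Series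
(f ⊕ g) n = f n + g n

infixl 7 _·_
_·_ : ℚ → Series → Series
(c · f) n = c * f n

infixr 8 _^_
_^_ : Series → ℕ → Series
f ^ zero  = 𝟏
f ^ suc k = f ⊛ f ^ k

-- The quotient (f - f(0))/x. Writing f = f(0) + x Δf lets statements about products be proved by
-- induction on the degree.
Δ : Series → Series
Δ f n = f (suc n)

D : Series → Series
D f n = ι (suc n) * f (suc n)

⊛-suc : ∀ f g n → (f ⊛ g) (suc n) ≡ f 0 * g (suc n) + (Δ f ⊛ g) n
⊛-suc f g n = Σ-upTo-suc (λ i → f i * g (suc n ℕ.∸ i)) (suc n)

⊛-cong : f ≗ f′ → g ≗ g′ → f ⊛ g ≗ f′ ⊛ g′
⊛-cong f≗ g≗ n = Σ-cong (λ i → cong₂ _*_ (f≗ i) (g≗ (n ℕ.∸ i))) (upTo (suc n))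

-- The mirror image of `⊛-suc`. The convolution unfolds from the left factor, so the last summand is
-- reached by induction through `Δ f`.
⊛-sucʳ : ∀ f g n → (f ⊛ g) (suc n) ≡ f (suc n) * g 0 + (f ⊛ Δ g) n
⊛-sucʳ f g zero    = solve 4 (λ a b c d → a :* b :+ (c :* d :+ con 0ℚ) := c :* d :+ (a :* b :+ con 0ℚ))
                       refl (f 0) (g 1) (f 1) (g 0)
⊛-sucʳ f g (suc n) = begin
  (f ⊛ g) (suc (suc n))
    ≡⟨ ⊛-suc f g (suc n) ⟩
  f 0 * g (suc (suc n)) + (Δ f ⊛ g) (suc n)
    ≡⟨ +-congˡ (f 0 * g (suc (suc n))) (⊛-sucʳ (Δ f) g n) ⟩
  f 0 * g (suc (suc n)) + (f (suc (suc n)) * g 0 + (Δ f ⊛ Δ g) n)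
    ≡⟨ solve 3 (λ a b c → a :+ (b :+ c) := b :+ (a :+ c)) refl
         (f 0 * g (suc (suc n))) (f (suc (suc n)) * g 0) ((Δ f ⊛ Δ g) n) ⟩
  f (suc (suc n)) * g 0 + (f 0 * g (suc (suc n)) + (Δ f ⊛ Δ g) n)
    ≡⟨ +-congˡ (f (suc (suc n)) * g 0) (⊛-suc f (Δ g) n) ⟨
  f (suc (suc n)) * g 0 + (f ⊛ Δ g) (suc n)
    ∎

-- Peeling the left factor of one product and the right factor of the other leaves the same claim
-- for `Δ f` and `g`, one degree lower.
⊛-comm : ∀ f g → f ⊛ g ≗ g ⊛ f
⊛-comm f g zero    = cong (_+ 0ℚ) (*-comm (f 0) (g 0))
⊛-comm f g (suc n) = begin
  (f ⊛ g) (suc n)                    ≡⟨ ⊛-suc f g n ⟩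
  f 0 * g (suc n) + (Δ f ⊛ g) n      ≡⟨ cong₂ _+_ (*-comm (f 0) (g (suc n))) (⊛-comm (Δ f) g n) ⟩
  g (suc n) * f 0 + (g ⊛ Δ f) n      ≡⟨ ⊛-sucʳ g f n ⟨
  (g ⊛ f) (suc n)                    ∎

⊛-distribˡ-⊕ : ∀ f g h → f ⊛ (g ⊕ h) ≗ f ⊛ g ⊕ f ⊛ h
⊛-distribˡ-⊕ f g h zero    = solve 3 (λ a b c → a :* (b :+ c) :+ con 0ℚ := (a :* b :+ con 0ℚ) :+ (a :* c :+ con 0ℚ))
                               refl (f 0) (g 0) (h 0)
⊛-distribˡ-⊕ f g h (suc n) = begin
  (f ⊛ (g ⊕ h)) (suc n)
    ≡⟨ ⊛-suc f (g ⊕ h) n ⟩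
  f 0 * (g (suc n) + h (suc n)) + (Δ f ⊛ (g ⊕ h)) n
    ≡⟨ +-congˡ (f 0 * (g (suc n) + h (suc n))) (⊛-distribˡ-⊕ (Δ f) g h n) ⟩
  f 0 * (g (suc n) + h (suc n)) + ((Δ f ⊛ g) n + (Δ f ⊛ h) n)
    ≡⟨ solve 5 (λ a b c x y → a :* (b :+ c) :+ (x :+ y) := (a :* b :+ x) :+ (a :* c :+ y))
         refl (f 0) (g (suc n)) (h (suc n)) ((Δ f ⊛ g) n) ((Δ f ⊛ h) n) ⟩
  (f 0 * g (suc n) + (Δ f ⊛ g) n) + (f 0 * h (suc n) + (Δ f ⊛ h) n)
    ≡⟨ cong₂ _+_ (⊛-suc f g n) (⊛-suc f h n) ⟨
  (f ⊛ g) (suc n) + (f ⊛ h) (suc n)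
    ∎

⊛-distribʳ-⊕ : ∀ f g h → (g ⊕ h) ⊛ f ≗ g ⊛ f ⊕ h ⊛ f
⊛-distribʳ-⊕ f g h n = begin
  ((g ⊕ h) ⊛ f) n            ≡⟨ ⊛-comm (g ⊕ h) f n ⟩
  (f ⊛ (g ⊕ h)) n            ≡⟨ ⊛-distribˡ-⊕ f g h n ⟩
  (f ⊛ g) n + (f ⊛ h) n      ≡⟨ cong₂ _+_ (⊛-comm f g n) (⊛-comm f h n) ⟩
  (g ⊛ f) n + (h ⊛ f) n      ∎

⊛-· : ∀ c f g → f ⊛ (c · g) ≗ c · (f ⊛ g)
⊛-· c f g n = trans
  (Σ-cong (λ i → solve 3 (λ a b d → b :* (a :* d) := a :* (b :* d)) refl c (f i) (g (n ℕ.∸ i))) (upTo (suc n)))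
  (Σ-*ˡ c (λ i → f i * g (n ℕ.∸ i)) (upTo (suc n)))

⊛-vanish : ∀ f g n → (∀ {i} → i ≤ n → g i ≡ 0ℚ) → (f ⊛ g) n ≡ 0ℚ
⊛-vanish f g n g≡0 = trans
  (Σ-cong (λ i → trans (cong (f i *_) (g≡0 (ℕ.m∸n≤m n i))) (*-zeroʳ (f i))) (upTo (suc n)))
  (Σ-zero (upTo (suc n)))

⊛-Σ : ∀ f (G : A → Series) xs n → (f ⊛ (λ m → Σ[ xs ] (λ x → G x m))) n ≡ Σ[ xs ] (λ x → (f ⊛ G x) n)
⊛-Σ f G []       n = ⊛-vanish f (λ _ → 0ℚ) n (λ _ → refl)
⊛-Σ f G (x ∷ xs) n = trans (⊛-distribˡ-⊕ f (G x) (λ m → Σ[ xs ] (λ y → G y m)) n)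
  (+-congˡ ((f ⊛ G x) n) (⊛-Σ f G xs n))

⊛-identityʳ : ∀ f → f ⊛ 𝟏 ≗ f
⊛-identityʳ f zero    = solve 1 (λ a → a :* con 1ℚ :+ con 0ℚ := a) refl (f 0)
⊛-identityʳ f (suc n) = begin
  (f ⊛ 𝟏) (suc n)                      ≡⟨ ⊛-sucʳ f 𝟏 n ⟩
  f (suc n) * 1ℚ + (f ⊛ Δ 𝟏) n         ≡⟨ cong₂ _+_ (*-identityʳ (f (suc n))) (⊛-vanish f (Δ 𝟏) n (λ _ → refl)) ⟩
  f (suc n) + 0ℚ                       ≡⟨ +-identityʳ (f (suc n)) ⟩
  f (suc n)                            ∎

⊛-identityˡ : ∀ f → 𝟏 ⊛ f ≗ f
⊛-identityˡ f n = trans (⊛-comm 𝟏 f n) (⊛-identityʳ f n)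

-- With constant term 1 in v, the coefficients of f can be read off from f v one after another.
-- Agreement is assumed only up to degree n because the truncated logarithm series satisfies its
-- equation only that far.
⊛-cancelʳ : ∀ {v} → v 0 ≡ 1ℚ → ∀ n f g → (∀ {m} → m ≤ n → (f ⊛ v) m ≡ (g ⊛ v) m) → f n ≡ g n
⊛-cancelʳ {v} v₀≡1 zero    f g eq = trans (head f) (trans (eq z≤n) (sym (head g)))
  where
  head : ∀ f → f 0 ≡ (f ⊛ v) 0
  head f = sym (trans (cong (λ w → f 0 * w + 0ℚ) v₀≡1) (solve 1 (λ a → a :* con 1ℚ :+ con 0ℚ := a) refl (f 0)))
⊛-cancelʳ {v} v₀≡1 (suc n) f g eq = ⊛-cancelʳ v₀≡1 n (Δ f) (Δ g) (λ {m} m≤n → begin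
  (Δ f ⊛ v) m                            ≡⟨ tail f m ⟩
  (f ⊛ v) (suc m) - f 0 * v (suc m)      ≡⟨ cong₂ (λ a b → a - b * v (suc m)) (eq (s≤s m≤n)) f₀≡g₀ ⟩
  (g ⊛ v) (suc m) - g 0 * v (suc m)      ≡⟨ tail g m ⟨
  (Δ g ⊛ v) m                            ∎)
  where
  f₀≡g₀ : f 0 ≡ g 0
  f₀≡g₀ = ⊛-cancelʳ v₀≡1 0 f g (λ m≤0 → eq (ℕ.≤-trans m≤0 z≤n))

  tail : ∀ f m → (Δ f ⊛ v) m ≡ (f ⊛ v) (suc m) - f 0 * v (suc m)
  tail f m = trans (solve 2 (λ a b → b := a :+ b :- a) refl (f 0 * v (suc m)) ((Δ f ⊛ v) m))
    (cong (_- f 0 * v (suc m)) (sym (⊛-suc f v m)))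

-- Induction on the degree through f = f(0) + x Δf: the product rule for `Δ f` and `g` is used one
-- degree lower, and D(x h) = h + x D h supplies the remaining terms.
D-⊛ : ∀ f g → D (f ⊛ g) ≗ D f ⊛ g ⊕ f ⊛ D g
D-⊛ f g zero    = solve 4 (λ a b c d → con 1ℚ :* (a :* b :+ (c :* d :+ con 0ℚ))
                    := con 1ℚ :* c :* d :+ con 0ℚ :+ (a :* (con 1ℚ :* b) :+ con 0ℚ)) refl (f 0) (g 1) (f 1) (g 0)
D-⊛ f g (suc n) = begin
  ι (suc (suc n)) * (f ⊛ g) (suc (suc n))
    ≡⟨ cong₂ _*_ (ι-suc (suc n)) (⊛-suc f g (suc n)) ⟩
  -- Splitting the factor n + 2 as 1 + (n + 1) makes `D (Δ f ⊛ g) n` appear, to which the induction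
  -- hypothesis applies.
  (1ℚ + ν) * (f 0 * g₂ + (Δ f ⊛ g) (suc n))
    ≡⟨ solve 4 (λ c a b d → (con 1ℚ :+ c) :* (a :* b :+ d) := a :* ((con 1ℚ :+ c) :* b) :+ (d :+ c :* d))
         refl ν (f 0) g₂ ((Δ f ⊛ g) (suc n)) ⟩
  f 0 * ((1ℚ + ν) * g₂) + ((Δ f ⊛ g) (suc n) + D (Δ f ⊛ g) n)
    ≡⟨ cong₂ _+_ (cong (λ c → f 0 * (c * g₂)) (sym (ι-suc (suc n)))) (cong₂ _+_ (⊛-suc (Δ f) g n) (D-⊛ (Δ f) g n)) ⟩
  f 0 * D g (suc n) + ((f 1 * g (suc n) + (Δ (Δ f) ⊛ g) n) + ((D (Δ f) ⊛ g) n + (Δ f ⊛ D g) n))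
    ≡⟨ solve 5 (λ a b c d e → a :+ ((b :+ c) :+ (d :+ e)) := (b :+ (c :+ d)) :+ (a :+ e)) refl
         (f 0 * D g (suc n)) (f 1 * g (suc n)) ((Δ (Δ f) ⊛ g) n) ((D (Δ f) ⊛ g) n) ((Δ f ⊛ D g) n) ⟩
  (f 1 * g (suc n) + ((Δ (Δ f) ⊛ g) n + (D (Δ f) ⊛ g) n)) + (f 0 * D g (suc n) + (Δ f ⊛ D g) n)
    ≡⟨ cong₂ (λ a b → (a * g (suc n) + b) + (f 0 * D g (suc n) + (Δ f ⊛ D g) n)) (sym (*-identityˡ (f 1)))
         (trans (sym (⊛-distribʳ-⊕ g (Δ (Δ f)) (D (Δ f)) n)) (⊛-cong {g = g} ΔD (λ _ → refl) n)) ⟩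
  (D f 0 * g (suc n) + (Δ (D f) ⊛ g) n) + (f 0 * D g (suc n) + (Δ f ⊛ D g) n)
    ≡⟨ cong₂ _+_ (⊛-suc (D f) g n) (⊛-suc f (D g) n) ⟨
  (D f ⊛ g) (suc n) + (f ⊛ D g) (suc n)
    ∎
  where
  ν = ι (suc n)
  g₂ = g (suc (suc n))

  -- Differentiating f = f(0) + x Δf gives D f = Δf + x D(Δf); this is its image under Δ.
  ΔD : Δ (Δ f) ⊕ D (Δ f) ≗ Δ (D f)
  ΔD m = trans (solve 2 (λ a c → a :+ c :* a := (con 1ℚ :+ c) :* a) refl (f (suc (suc m))) (ι (suc m)))
    (cong (_* f (suc (suc m))) (sym (ι-suc (suc m))))

-- Powers of eˣ - 1

u : Series
u = exp ⊖ 𝟏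

/!-inverse : ∀ n → ι (n !) * (1ℤ /! n) ≡ 1ℚ
/!-inverse n = ι-inverse (n !) {{n ℕ.!≢0}}

D-exp : D exp ≗ exp
D-exp n = ι-cancelˡ (n !) {{n ℕ.!≢0}} (begin
  ι (n !) * (ι (suc n) * (1ℤ /! suc n))   ≡⟨ solve 3 (λ a b c → a :* (b :* c) := b :* a :* c) refl
                                               (ι (n !)) (ι (suc n)) (1ℤ /! suc n) ⟩
  ι (suc n) * ι (n !) * (1ℤ /! suc n)     ≡⟨ cong (_* (1ℤ /! suc n)) (ι-* (suc n) (n !)) ⟨
  ι (suc n !) * (1ℤ /! suc n)             ≡⟨ /!-inverse (suc n) ⟩
  1ℚ                                      ≡⟨ /!-inverse n ⟨
  ι (n !) * (1ℤ /! n)                     ∎)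

D-u : D u ≗ u ⊕ 𝟏
D-u n = begin
  ι (suc n) * (exp (suc n) - 0ℚ)    ≡⟨ solve 2 (λ a b → a :* (b :- con 0ℚ) := a :* b) refl (ι (suc n)) (exp (suc n)) ⟩
  ι (suc n) * exp (suc n)           ≡⟨ D-exp n ⟩
  exp n                             ≡⟨ solve 2 (λ a b → a := a :- b :+ b) refl (exp n) (𝟏 n) ⟩
  exp n - 𝟏 n + 𝟏 n                 ∎

-- With w = uᵏ⁺¹, the product rule gives u′w = uw + w, and the induction hypothesis turns u w′ into
-- (k + 1)(uw + w), as u uᵏ is w by definition. Together they carry the factor k + 2.
D-u^ : ∀ k → D (u ^ suc k) ≗ ι (suc k) · (u ^ suc k ⊕ u ^ k)
D-u^ zero n = begin
  ι (suc n) * (u ⊛ 𝟏) (suc n)      ≡⟨ cong (ι (suc n) *_) (⊛-identityʳ u (suc n)) ⟩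
  D u n                            ≡⟨ D-u n ⟩
  u n + 𝟏 n                        ≡⟨ *-identityˡ (u n + 𝟏 n) ⟨
  1ℚ * (u n + 𝟏 n)                 ≡⟨ cong (λ r → 1ℚ * (r + 𝟏 n)) (⊛-identityʳ u n) ⟨
  1ℚ * ((u ⊛ 𝟏) n + 𝟏 n)           ∎
D-u^ (suc k) n = begin
  D (u ⊛ w) n
    ≡⟨ D-⊛ u w n ⟩
  (D u ⊛ w) n + (u ⊛ D w) n
    ≡⟨ cong₂ _+_ (⊛-cong {g = w} D-u (λ _ → refl) n) (⊛-cong {f = u} (λ _ → refl) (D-u^ k) n) ⟩
  ((u ⊕ 𝟏) ⊛ w) n + (u ⊛ (ι (suc k) · (w ⊕ u ^ k))) n
    ≡⟨ cong₂ _+_ (⊛-distribʳ-⊕ w u 𝟏 n)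
         (trans (⊛-· (ι (suc k)) u (w ⊕ u ^ k) n) (cong (ι (suc k) *_) (⊛-distribˡ-⊕ u w (u ^ k) n))) ⟩
  ((u ⊛ w) n + (𝟏 ⊛ w) n) + ι (suc k) * ((u ⊛ w) n + w n)
    ≡⟨ cong (λ r → ((u ⊛ w) n + r) + ι (suc k) * ((u ⊛ w) n + w n)) (⊛-identityˡ w n) ⟩
  ((u ⊛ w) n + w n) + ι (suc k) * ((u ⊛ w) n + w n)
    ≡⟨ solve 2 (λ a c → a :+ c :* a := (con 1ℚ :+ c) :* a) refl ((u ⊛ w) n + w n) (ι (suc k)) ⟩
  (1ℚ + ι (suc k)) * ((u ⊛ w) n + w n)
    ≡⟨ cong (_* ((u ⊛ w) n + w n)) (ι-suc (suc k)) ⟨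
  ι (suc (suc k)) * ((u ⊛ w) n + w n)
    ∎
  where w = u ^ suc k

-- The constant term of u evaluates to 0, so u = x Δu. Since Δu has constant term 1, a product with
-- u becomes cancellable after lowering the degree by one.
u⊛-suc : ∀ f n → (u ⊛ f) (suc n) ≡ (Δ u ⊛ f) n
u⊛-suc f n = begin
  (u ⊛ f) (suc n)                      ≡⟨ ⊛-suc u f n ⟩
  0ℚ * f (suc n) + (Δ u ⊛ f) n         ≡⟨ solve 2 (λ a b → con 0ℚ :* a :+ b := b) refl (f (suc n)) ((Δ u ⊛ f) n) ⟩
  (Δ u ⊛ f) n                          ∎

u⊛-zero : ∀ f → (u ⊛ f) 0 ≡ 0ℚ
u⊛-zero f = solve 1 (λ a → con 0ℚ :* a :+ con 0ℚ := con 0ℚ) refl (f 0)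

-- Each factor u = x Δu raises the order by at least one.
u^-vanish : ∀ {n k} → n < k → (u ^ k) n ≡ 0ℚ
u^-vanish {zero}  {suc k} _         = u⊛-zero (u ^ k)
u^-vanish {suc n} {suc k} (s≤s n<k) = trans (u⊛-suc (u ^ k) n)
  (⊛-vanish (Δ u) (u ^ k) n (λ i≤n → u^-vanish (ℕ.≤-<-trans i≤n n<k)))

-- The logarithm series

logCoeff : ℕ → ℚ
logCoeff k = sgn k * (1ℤ / suc k)

-- Formally log(1 + u)/u = x/(eˣ - 1). Stopping at uᴺ keeps the sum finite and changes nothing
-- through degree N, as uᵏ starts in degree k.
log[1+u]/u : ℕ → Series
log[1+u]/u N m = Σ[ upTo (suc N) ] (λ k → logCoeff k * (u ^ k) m)

u⊛log[1+u]/u : ∀ {m} N → m ≤ N → (u ⊛ log[1+u]/u N) (suc m) ≡ X (suc m)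
-- Multiplying by m + 1 compares the derivatives of the two sides in degree m.
u⊛log[1+u]/u {m} N m≤N = ι-cancelˡ (suc m) (begin
  ι (suc m) * (u ⊛ log[1+u]/u N) (suc m)
    ≡⟨ cong (ι (suc m) *_) (trans (⊛-Σ u (λ k → logCoeff k · u ^ k) ks (suc m))
         (Σ-cong (λ k → ⊛-· (logCoeff k) u (u ^ k) (suc m)) ks)) ⟩
  ι (suc m) * Σ[ ks ] (λ k → logCoeff k * (u ^ suc k) (suc m))
    ≡⟨ Σ-*ˡ (ι (suc m)) (λ k → logCoeff k * (u ^ suc k) (suc m)) ks ⟨
  Σ[ ks ] (λ k → ι (suc m) * (logCoeff k * (u ^ suc k) (suc m)))
    ≡⟨ Σ-cong term ks ⟩
  Σ[ ks ] (λ k → sgn k * ((u ^ suc k) m + (u ^ k) m))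
    ≡⟨ Σ-telescope (λ k → (u ^ k) m) (suc N) ⟩
  𝟏 m - sgn (suc N) * (u ^ suc N) m
    -- The end term of the telescoping sum is uᴺ⁺¹, whose order exceeds m.
    ≡⟨ cong (λ r → 𝟏 m - sgn (suc N) * r) (u^-vanish (s≤s m≤N)) ⟩
  𝟏 m - sgn (suc N) * 0ℚ
    ≡⟨ solve 2 (λ a b → a :- b :* con 0ℚ := a) refl (𝟏 m) (sgn (suc N)) ⟩
  𝟏 m
    ≡⟨ 𝟏≡DX m ⟩
  ι (suc m) * X (suc m)
    ∎)
  where
  ks = upTo (suc N)

  term : ∀ k → ι (suc m) * (logCoeff k * (u ^ suc k) (suc m)) ≡ sgn k * ((u ^ suc k) m + (u ^ k) m)
  term k = begin
    ι (suc m) * (sgn k * (1ℤ / suc k) * (u ^ suc k) (suc m))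
      ≡⟨ solve 4 (λ a b c d → a :* (b :* c :* d) := b :* c :* (a :* d)) refl
           (ι (suc m)) (sgn k) (1ℤ / suc k) ((u ^ suc k) (suc m)) ⟩
    sgn k * (1ℤ / suc k) * D (u ^ suc k) m
      ≡⟨ cong (sgn k * (1ℤ / suc k) *_) (D-u^ k m) ⟩
    sgn k * (1ℤ / suc k) * (ι (suc k) * s)
      ≡⟨ solve 4 (λ a b c d → a :* b :* (c :* d) := a :* ((c :* b) :* d)) refl (sgn k) (1ℤ / suc k) (ι (suc k)) s ⟩
    sgn k * (ι (suc k) * (1ℤ / suc k) * s)
      ≡⟨ cong (λ r → sgn k * (r * s)) (ι-inverse (suc k)) ⟩
    sgn k * (1ℚ * s)
      ≡⟨ cong (sgn k *_) (*-identityˡ s) ⟩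
    sgn k * s
      ∎
    where s = (u ^ suc k) m + (u ^ k) m

  𝟏≡DX : ∀ m → 𝟏 m ≡ ι (suc m) * X (suc m)
  𝟏≡DX zero    = refl
  𝟏≡DX (suc m) = sym (*-zeroʳ (ι (suc (suc m))))

-- Both series times u equal x through degree n + 1. Dividing by x leaves products with `Δ u`, which
-- can be cancelled; truncating at n is enough for degree n.
bernoulli-egf : ∀ b → IsBernoulli b → ∀ n → egf b n ≡ log[1+u]/u n n
bernoulli-egf b isB n = ⊛-cancelʳ {v = Δ u} refl n (egf b) (log[1+u]/u n) (λ {m} m≤n → begin
  (egf b ⊛ Δ u) m                  ≡⟨ ⊛-comm (egf b) (Δ u) m ⟩
  (Δ u ⊛ egf b) m                  ≡⟨ u⊛-suc (egf b) m ⟨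
  (u ⊛ egf b) (suc m)              ≡⟨ ⊛-comm u (egf b) (suc m) ⟩
  (egf b ⊛ u) (suc m)              ≡⟨ isB (suc m) ⟩
  X (suc m)                        ≡⟨ u⊛log[1+u]/u n m≤n ⟨
  (u ⊛ log[1+u]/u n) (suc m)       ≡⟨ u⊛-suc (log[1+u]/u n) m ⟩
  (Δ u ⊛ log[1+u]/u n) m           ≡⟨ ⊛-comm (Δ u) (log[1+u]/u n) m ⟩
  (log[1+u]/u n ⊛ Δ u) m           ∎)

-- These numbers count the surjections from an n-set onto a k-set. Comparing coefficients in `D-u^`
-- gives the recurrence a(n+1, k+1) = (k+1)(a(n, k+1) + a(n, k)).
!*u^-isInteger : ∀ n k → IsInteger (ι (n !) * (u ^ k) n)
!*u^-isInteger zero    zero    = + 1 , refl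
!*u^-isInteger zero    (suc k) = + 0 , trans (cong (1ℚ *_) (u⊛-zero (u ^ k))) refl
!*u^-isInteger (suc n) zero    = + 0 , *-zeroʳ (ι (suc n !))
!*u^-isInteger (suc n) (suc k) = subst IsInteger (sym eq)
  (*-isInteger (+ suc k , refl) (+-isInteger (!*u^-isInteger n (suc k)) (!*u^-isInteger n k)))
  where
  eq : ι (suc n !) * (u ^ suc k) (suc n) ≡ ι (suc k) * (ι (n !) * (u ^ suc k) n + ι (n !) * (u ^ k) n)
  eq = begin
    ι (suc n !) * (u ^ suc k) (suc n)
      ≡⟨ cong (_* (u ^ suc k) (suc n)) (ι-* (suc n) (n !)) ⟩
    ι (suc n) * ι (n !) * (u ^ suc k) (suc n)
      ≡⟨ solve 3 (λ a b c → a :* b :* c := b :* (a :* c)) refl (ι (suc n)) (ι (n !)) ((u ^ suc k) (suc n)) ⟩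
    ι (n !) * D (u ^ suc k) n
      ≡⟨ cong (ι (n !) *_) (D-u^ k n) ⟩
    ι (n !) * (ι (suc k) * ((u ^ suc k) n + (u ^ k) n))
      ≡⟨ solve 4 (λ a b c d → a :* (b :* (c :+ d)) := b :* (a :* c :+ a :* d)) refl
           (ι (n !)) (ι (suc k)) ((u ^ suc k) n) ((u ^ k) n) ⟩
    ι (suc k) * (ι (n !) * (u ^ suc k) n + ι (n !) * (u ^ k) n)
      ∎

-- Sums over compositions

-- A product of reciprocals rather than the reciprocal of a product, so that prepending an entry
-- multiplies by a coefficient of eˣ.
weight : ∀ {k} → Vec ℕ k → ℚ
weight []      = 1ℚ
weight (x ∷ v) = (1ℤ /! x) * weight v

multinomial≡!*weight : ∀ {k} n (v : Vec ℕ k) → multinomial n v ≡ ι (n !) * weight v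
multinomial≡!*weight n v = trans (/-as-* (+ (n !)) (product (List.map _! (toList v))) {{nonZero v}})
  (cong (ι (n !) *_) (1/product v))
  where
  -- Instance arguments of `_/_` are irrelevant, so this proof may replace the one inside
  -- `multinomial`.
  nonZero : ∀ {k} (v : Vec ℕ k) → NonZero (product (List.map _! (toList v)))
  nonZero []      = _
  nonZero (x ∷ v) = ℕ.m*n≢0 (x !) _ {{x ℕ.!≢0}} {{nonZero v}}

  1/product : ∀ {k} (v : Vec ℕ k) → (1ℤ / product (List.map _! (toList v))) {{nonZero v}} ≡ weight v
  1/product []      = refl
  1/product (x ∷ v) = begin
    (1ℤ / (x ! ℕ.* π)) {{nonZero (x ∷ v)}}     ≡⟨ /-*-/ 1ℤ 1ℤ (x !) π {{x ℕ.!≢0}} {{nonZero v}} {{nonZero (x ∷ v)}} ⟨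
    (1ℤ /! x) * ((1ℤ / π) {{nonZero v}})       ≡⟨ cong ((1ℤ /! x) *_) (1/product v) ⟩
    (1ℤ /! x) * weight v                       ∎
    where π = product (List.map _! (toList v))

-- shift s f = xˢ f
shift : ℕ → Series → Series
shift zero    f n       = f n
shift (suc s) f zero    = 0ℚ
shift (suc s) f (suc n) = shift s f n

shift-cong : ∀ s {n} → (∀ {m} → m ≤ n → f m ≡ g m) → shift s f n ≡ shift s g n
shift-cong zero            eq = eq ℕ.≤-refl
shift-cong (suc s) {zero}  eq = refl
shift-cong (suc s) {suc n} eq = shift-cong s (eq ∘ ℕ.m≤n⇒m≤1+n)

-- Expands f g over the monomials of f. Those of degree above m contribute nothing, so one bound N
-- serves all degrees below it.
Σ-shift : ∀ f g {N m} → m < N → Σ[ upTo N ] (λ i → f i * shift i g m) ≡ (f ⊛ g) m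
Σ-shift f g {suc N} {zero} _ = trans (Σ-upTo-suc (λ i → f i * shift i g 0) N)
  (+-congˡ (f 0 * g 0) (trans (Σ-cong (λ i → *-zeroʳ (f (suc i))) (upTo N)) (Σ-zero (upTo N))))
Σ-shift f g {suc N} {suc m} (s≤s m<N) = begin
  Σ[ upTo (suc N) ] (λ i → f i * shift i g (suc m))                    ≡⟨ Σ-upTo-suc (λ i → f i * shift i g (suc m)) N ⟩
  f 0 * g (suc m) + Σ[ upTo N ] (λ i → Δ f i * shift i g m)            ≡⟨ +-congˡ (f 0 * g (suc m)) (Σ-shift (Δ f) g m<N) ⟩
  f 0 * g (suc m) + (Δ f ⊛ g) m                                        ≡⟨ ⊛-suc f g m ⟨
  (f ⊛ g) (suc m)                                                      ∎

Σ-cartesianProductWith : ∀ {k} (F : Vec A (suc k) → ℚ) xs vs →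
  Σ[ cartesianProductWith _∷_ xs vs ] F ≡ Σ[ xs ] (λ x → Σ[ vs ] (λ v → F (x ∷ v)))
Σ-cartesianProductWith F []       vs = refl
Σ-cartesianProductWith F (x ∷ xs) vs = trans
  (Σ-++ F (List.map (x ∷_) vs) (cartesianProductWith _∷_ xs vs))
  (cong₂ _+_ (Σ-map (x ∷_) F vs) (Σ-cartesianProductWith F xs vs))

-- An indicator in place of `filter` keeps the sum over all tuples, which can then be split by the
-- first entry.
when-sum : ∀ {k} → ℕ → (Vec ℕ k → ℚ) → Vec ℕ k → ℚ
when-sum n F v = if does (Vec.sum v ℕ.≟ n) then F v else 0ℚ

-- The tail must sum to n - x, and no tail qualifies when x exceeds n; `shift` records both cases
-- without subtraction.
Σ-when-sum-∷ : ∀ {k} x (F : Vec ℕ (suc k) → ℚ) vs n →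
  Σ[ vs ] (λ v → when-sum n F (x ∷ v)) ≡ shift x (λ m → Σ[ vs ] (when-sum m (λ v → F (x ∷ v)))) n
Σ-when-sum-∷ x F vs n = go x n
  where
  -- The amount `s` is separated from the entry `x` kept inside `F`, so that `s` and `n` can be
  -- counted down together. Each clause relies on the test `does (_ ≟ _)` dropping a common `suc` or
  -- failing by computation.
  go : ∀ s n → Σ[ vs ] (λ v → if does (s ℕ.+ Vec.sum v ℕ.≟ n) then F (x ∷ v) else 0ℚ)
               ≡ shift s (λ m → Σ[ vs ] (when-sum m (λ v → F (x ∷ v)))) n
  go zero    n       = refl
  go (suc s) zero    = Σ-zero vs
  go (suc s) (suc n) = go s n

if-*ˡ : ∀ b c q → (if b then c * q else 0ℚ) ≡ c * (if b then q else 0ℚ)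
if-*ˡ true  c q = refl
if-*ˡ false c q = sym (*-zeroʳ c)

shift-· : ∀ s c f n → shift s (c · f) n ≡ c * shift s f n
shift-· zero    c f n       = refl
shift-· (suc s) c f zero    = sym (*-zeroʳ c)
shift-· (suc s) c f (suc n) = shift-· s c f n

-- The k-th power of the polynomial with terms tˣ/x! for x in `xs`, expanded into one monomial per
-- tuple.
tupleSeries : List ℕ → ℕ → Series
tupleSeries xs k n = Σ[ tuples xs k ] (when-sum n weight)

tupleSeries-suc : ∀ xs k n →
  tupleSeries xs (suc k) n ≡ Σ[ xs ] (λ x → exp x * shift x (tupleSeries xs k) n)
tupleSeries-suc xs k n = trans (Σ-cartesianProductWith (when-sum n weight) xs (tuples xs k)) (Σ-cong (λ x → begin
  Σ[ tuples xs k ] (λ v → when-sum n weight (x ∷ v))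
    ≡⟨ Σ-when-sum-∷ x weight (tuples xs k) n ⟩
  shift x (λ m → Σ[ tuples xs k ] (when-sum m (λ v → exp x * weight v))) n
    ≡⟨ shift-cong x {n} (λ {m} _ → trans
         (Σ-cong (λ v → if-*ˡ (does (Vec.sum v ℕ.≟ m)) (exp x) (weight v)) (tuples xs k))
         (Σ-*ˡ (exp x) (when-sum m weight) (tuples xs k))) ⟩
  shift x (exp x · tupleSeries xs k) n
    ≡⟨ shift-· x (exp x) (tupleSeries xs k) n ⟩
  exp x * shift x (tupleSeries xs k) n
    ∎) xs)

-- Entries from 1 to N amount to truncating u after degree N, which is invisible in degrees up to N.
-- The bound N stays fixed while the induction on k visits smaller degrees.
tupleSeries≡u^ : ∀ {N} k {n} → n ≤ N → tupleSeries [1⋯ N ] k n ≡ (u ^ k) n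
tupleSeries≡u^     zero    {zero}  _ = refl
tupleSeries≡u^     zero    {suc n} _ = refl
tupleSeries≡u^ {N} (suc k) {n}     n≤N = begin
  tupleSeries [1⋯ N ] (suc k) n
    ≡⟨ tupleSeries-suc [1⋯ N ] k n ⟩
  Σ[ [1⋯ N ] ] (λ x → exp x * shift x (tupleSeries [1⋯ N ] k) n)
    ≡⟨ Σ-cong (λ x → cong (exp x *_) (shift-cong x (λ m≤n → tupleSeries≡u^ k (ℕ.≤-trans m≤n n≤N)))) [1⋯ N ] ⟩
  Σ[ [1⋯ N ] ] (λ x → exp x * shift x (u ^ k) n)
    ≡⟨ Σ-1⋯ (λ x → exp x * shift x (u ^ k) n) N ⟩
  Σ[ upTo N ] (λ i → exp (suc i) * shift (suc i) (u ^ k) n)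
    ≡⟨ Σ-cong (λ i → cong (_* shift (suc i) (u ^ k) n)
         (solve 1 (λ a → a := a :- con 0ℚ) refl (exp (suc i)))) (upTo N) ⟩
  Σ[ upTo N ] (λ i → Δ u i * shift (suc i) (u ^ k) n)
    ≡⟨ last n≤N ⟩
  (u ^ suc k) n
    ∎
  where
  -- Entries start at 1, so every summand carries a factor x, just as u = x Δu does; it is removed
  -- by lowering the degree.
  last : ∀ {n} → n ≤ N → Σ[ upTo N ] (λ i → Δ u i * shift (suc i) (u ^ k) n) ≡ (u ^ suc k) n
  last {zero}  _   = trans (Σ-cong (λ i → *-zeroʳ (Δ u i)) (upTo N)) (trans (Σ-zero (upTo N)) (sym (u⊛-zero (u ^ k))))
  last {suc m} m<N = trans (Σ-shift (Δ u) (u ^ k) m<N) (sym (u⊛-suc (u ^ k) m))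

Σ-multinomial : ∀ n k → Σ[ compositions n k ] (multinomial n) ≡ ι (n !) * (u ^ k) n
Σ-multinomial n k = begin
  Σ[ compositions n k ] (multinomial n)
    ≡⟨ Σ-cong (multinomial≡!*weight n) (compositions n k) ⟩
  Σ[ compositions n k ] (λ v → ι (n !) * weight v)
    ≡⟨ Σ-*ˡ (ι (n !)) weight (compositions n k) ⟩
  ι (n !) * Σ[ compositions n k ] weight
    ≡⟨ cong (ι (n !) *_) (Σ-filter (λ v → Vec.sum v ℕ.≟ n) weight (tuples [1⋯ n ] k)) ⟩
  ι (n !) * tupleSeries [1⋯ n ] k n
    ≡⟨ cong (ι (n !) *_) (tupleSeries≡u^ k ℕ.≤-refl) ⟩
  ι (n !) * (u ^ k) n
    ∎

-- The Bernoulli formula and its common denominator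

bernoulliTerm : ℕ → ℕ → ℚ
bernoulliTerm n k = logCoeff k * Σ[ compositions n k ] (multinomial n)

bernoulli-formula : ∀ b → IsBernoulli b → ∀ n → 1 ≤ n → b n ≡ Σ[ [1⋯ n ] ] (bernoulliTerm n)
bernoulli-formula b isB n@(suc n-1) _ = begin
  b n
    ≡⟨ *-identityʳ (b n) ⟨
  b n * 1ℚ
    ≡⟨ cong (b n *_) (/!-inverse n) ⟨
  b n * (ι (n !) * (1ℤ /! n))
    ≡⟨ solve 3 (λ a b c → a :* (b :* c) := b :* (a :* c)) refl (b n) (ι (n !)) (1ℤ /! n) ⟩
  ι (n !) * egf b n
    ≡⟨ cong (ι (n !) *_) (trans (bernoulli-egf b isB n) (Σ-upTo-suc (λ k → logCoeff k * (u ^ k) n) n)) ⟩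
  -- As n is a successor, `(u ^ 0) n` computes to `0ℚ`. This is where n ≥ 1 enters and why the sum
  -- starts at k = 1.
  ι (n !) * (logCoeff 0 * 0ℚ + Σ[ upTo n ] (λ k → logCoeff (suc k) * (u ^ suc k) n))
    ≡⟨ cong (ι (n !) *_) (trans (cong (λ r → r + S) (*-zeroʳ (logCoeff 0))) (+-identityˡ S)) ⟩
  ι (n !) * Σ[ upTo n ] (λ k → logCoeff (suc k) * (u ^ suc k) n)
    ≡⟨ cong (ι (n !) *_) (Σ-1⋯ (λ k → logCoeff k * (u ^ k) n) n) ⟨
  ι (n !) * Σ[ [1⋯ n ] ] (λ k → logCoeff k * (u ^ k) n)
    ≡⟨ Σ-*ˡ (ι (n !)) (λ k → logCoeff k * (u ^ k) n) [1⋯ n ] ⟨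
  Σ[ [1⋯ n ] ] (λ k → ι (n !) * (logCoeff k * (u ^ k) n))
    ≡⟨ Σ-cong (λ k → trans
         (solve 3 (λ a b c → a :* (b :* c) := b :* (a :* c)) refl (ι (n !)) (logCoeff k) ((u ^ k) n))
         (cong (logCoeff k *_) (sym (Σ-multinomial n k)))) [1⋯ n ] ⟩
  Σ[ [1⋯ n ] ] (bernoulliTerm n)
    ∎
  where S = Σ[ upTo n ] (λ k → logCoeff (suc k) * (u ^ suc k) n)

-- k + 1 divides (n + 1)! for k ≤ n, and n! [xⁿ](eˣ - 1)ᵏ is an integer.
bernoulliTerm-isInteger : ∀ {n k} → k ≤ n → IsInteger (ι (suc n !) * bernoulliTerm n k)
bernoulliTerm-isInteger {n} {k} k≤n = subst IsInteger (sym eq)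
  (*-isInteger (-1ℤ ℤ.^ k , refl) (*-isInteger
    (∣⇒isInteger {suc k} {suc n !} (∣-trans (m∣m*n (k !)) (m≤n⇒m!∣n! (s≤s k≤n))))
    (!*u^-isInteger n k)))
  where
  eq : ι (suc n !) * bernoulliTerm n k ≡ sgn k * (ι (suc n !) * (1ℤ / suc k) * (ι (n !) * (u ^ k) n))
  eq = trans (cong (λ r → ι (suc n !) * (logCoeff k * r)) (Σ-multinomial n k))
    (solve 4 (λ a b c d → a :* (b :* c :* d) := b :* (a :* c :* d)) refl
      (ι (suc n !)) (sgn k) (1ℤ / suc k) (ι (n !) * (u ^ k) n))

[1⋯n]≤n : ∀ n → All (_≤ n) [1⋯ n ]
-- The hypothesis i < n unfolds to `suc i ≤ n`, which is the bound on the entry `suc i`.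
[1⋯n]≤n n = subst (All (_≤ n)) (sym (map-upTo suc n)) (applyUpTo⁺₁ suc n (λ i<n → i<n))

corollary2p22 : (b : ℕ → ℚ) → IsBernoulli b → (n : ℕ) → 1 ≤ n →
    ∃ λ (N : ℤ) →
    (N / 1 ≡ (+ (suc n !) / 1)
    * (Σ[ [1⋯ n ] ] λ k →
    ((-1ℤ ℤ.^ k) / 1) * (1ℤ / suc k)
    * Σ[ compositions n k ] (multinomial n)))
    × (b n ≡ N /! suc n)
corollary2p22 b isB n 1≤n = fraction
  -- Integrality is checked term by term with (n + 1)! inside the sum, and the factor is then pulled
  -- out.
  (subst IsInteger (Σ-*ˡ (ι (suc n !)) (bernoulliTerm n) [1⋯ n ])
    (Σ-isInteger (All.map bernoulliTerm-isInteger ([1⋯n]≤n n))))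
  where
  S = Σ[ [1⋯ n ] ] (bernoulliTerm n)

  fraction : IsInteger (ι (suc n !) * S) → ∃ λ N → (N / 1 ≡ ι (suc n !) * S) × (b n ≡ N /! suc n)
  fraction (N , eq) = N , sym eq , (begin
    b n                                      ≡⟨ bernoulli-formula b isB n 1≤n ⟩
    S                                        ≡⟨ *-identityˡ S ⟨
    1ℚ * S                                   ≡⟨ cong (_* S) (/!-inverse (suc n)) ⟨
    ι (suc n !) * (1ℤ /! suc n) * S          ≡⟨ solve 3 (λ a b c → a :* b :* c := a :* c :* b) refl
                                                  (ι (suc n !)) (1ℤ /! suc n) S ⟩
    ι (suc n !) * S * (1ℤ /! suc n)          ≡⟨ cong (_* (1ℤ /! suc n)) eq ⟩
    (N / 1) * (1ℤ /! suc n)                  ≡⟨ /-as-* N (suc n !) {{suc n ℕ.!≢0}} ⟨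
    N /! suc n                               ∎)
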